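{- Every simply-typed term of the $\lambda{\tt x}$-calculus is strongly normalizing: if $\Gamma\vdash t:A$ is derivable, then there is no infinite reduction sequence of the $\lambda{\tt x}$-calculus starting from $t$.
   Context: Terms of the $\lambda{\tt x}$-calculus: $t ::= x \mid (t\ t)\mid \lambda x.t\mid t[t/x]$, where $x$ is bound in $t$ in both $\lambda x.t$ and $t[u/x]$; terms are considered modulo $\alpha$-conversion. Reduction is the closure under all term contexts of the rules $(\lambda x.t)\,u\to t[u/x]$; $(t\ u)[v/x]\to (t[v/x])\ (u[v/x])$; $(\lambda x.t)[u/y]\to\lambda x.(t[u/y])$ (applied modulo $\alpha$-conversion of the bound variable $x$, avoiding capture); $x[t/x]\to t$; $y[t/x]\to y$ (for $y\neq x$). Simple types are built from atomic types with $\to$. Typing rules: $\Gamma,x:A\vdash x:A$; from $\Gamma\vdash u:B$ and $\Gamma,x:B\vdash t:A$ infer $\Gamma\vdash t[u/x]:A$; from $\Gamma\vdash t:B\to A$ and $\Gamma\vdash u:B$ infer $\Gamma\vdash (t\ u):A$; from $\Gamma,x:B\vdash t:A$ infer $\Gamma\vdash\lambda x.t:B\to A$. -}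

module Defs where

open import Data.Fin.Base using (Fin; zero; suc; lift)
open import Data.Nat.Base using (ℕ; suc)
open import Data.Vec.Base using (Vec; _∷_; lookup)
open import Relation.Binary.PropositionalEquality.Core using (_≡_)

infixl 7 _·_
infix  6 ƛ_
infixl 8 _[_]
infixr 6 _⇒_
infix  4 _⟶_ _⊢_∶_

-- Terms modulo α-conversion are represented by well-scoped de Bruijn terms:
-- `Term n` has its free variables among n given ones.  In `ƛ t` and in the
-- explicit substitution `t [ u ]` (written t[u/x] with names), the index 0
-- is bound in t; u lies outside the scope of that binder.
data Term (n : ℕ) : Set where
  var  : Fin n → Term n
  _·_  : Term n → Term n → Term n
  ƛ_   : Term (suc n) → Term n
  _[_] : Term (suc n) → Term n → Term n

rename : ∀ {m n} → (Fin m → Fin n) → Term m → Term n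
rename ρ (var i)   = var (ρ i)
rename ρ (t · u)   = rename ρ t · rename ρ u
rename ρ (ƛ t)     = ƛ rename (lift 1 ρ) t
rename ρ (t [ u ]) = rename (lift 1 ρ) t [ rename ρ u ]

weaken : ∀ {n} → Term n → Term (suc n)
weaken = rename suc

exchange : ∀ {n} → Fin (suc (suc n)) → Fin (suc (suc n))
exchange zero          = suc zero
exchange (suc zero)    = zero
exchange (suc (suc i)) = suc (suc i)

data _⟶_ {n : ℕ} : Term n → Term n → Set where
  beta   : ∀ {t u} → (ƛ t) · u ⟶ t [ u ]
  []-app : ∀ {t u v} → (t · u) [ v ] ⟶ (t [ v ]) · (u [ v ])
  -- (λx.t)[u/y] → λx.(t[u/y]): on the left x is 0 and y is 1 in t, whereas
  -- on the right y is bound innermost; weakening u makes the rule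
  -- capture-avoiding.
  []-lam : ∀ {t u} → (ƛ t) [ u ] ⟶ ƛ (rename exchange t [ weaken u ])
  []-hit : ∀ {t} → var zero [ t ] ⟶ t
  []-var : ∀ {i t} → var (suc i) [ t ] ⟶ var i
  ·ˡ     : ∀ {t t′ u} → t ⟶ t′ → t · u ⟶ t′ · u
  ·ʳ     : ∀ {t u u′} → u ⟶ u′ → t · u ⟶ t · u′
  ƛ-cong : ∀ {t t′} → t ⟶ t′ → ƛ t ⟶ ƛ t′
  []ˡ    : ∀ {t t′ u} → t ⟶ t′ → t [ u ] ⟶ t′ [ u ]
  []ʳ    : ∀ {t u u′} → u ⟶ u′ → t [ u ] ⟶ t [ u′ ]

data Type (Atom : Set) : Set where
  atom : Atom → Type Atom
  _⇒_  : Type Atom → Type Atom → Type Atom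

-- Entry i of a context is the type declared for the variable i.
Ctx : Set → ℕ → Set
Ctx Atom n = Vec (Type Atom) n

data _⊢_∶_ {Atom : Set} {n : ℕ} (Γ : Ctx Atom n) : Term n → Type Atom → Set where
  ⊢var : ∀ {i A} → lookup Γ i ≡ A → Γ ⊢ var i ∶ A
  ⊢sub : ∀ {t u A B} → Γ ⊢ u ∶ B → (B ∷ Γ) ⊢ t ∶ A → Γ ⊢ t [ u ] ∶ A
  ⊢app : ∀ {t u A B} → Γ ⊢ t ∶ B ⇒ A → Γ ⊢ u ∶ B → Γ ⊢ t · u ∶ A
  ⊢lam : ∀ {t A B} → (B ∷ Γ) ⊢ t ∶ A → Γ ⊢ ƛ t ∶ B ⇒ A

{-# OPTIONS --safe #-}

-- Types are interpreted by functionals over ℕ, a substitution t[u/x] by the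
-- value of t at x ↦ u, and an application by the value of the function raised
-- by one plus the sizes of both parts.  Reduction then never increases the
-- label of a typed term (its value at zero, evaluated in the zero
-- environment), a head β-step decreases it, and an application or abstraction
-- has at least the label of its immediate subterms.  So (t u) and t[u/x] are
-- strongly normalizing as soon as t and u are, by a simultaneous induction on
-- the label and then on t and u: the substitution rules apply the induction
-- hypothesis to subterms of t, with a label that did not grow, and the
-- β-rule turns an application into a substitution with a smaller label.
module Submission where

open import Defs
open import Data.Fin.Base using (Fin; zero; suc; lift)
open import Data.Nat.Base using (ℕ; zero; suc; _+_; _≤_; _<_; s≤s; z≤n)
open import Data.Nat.Properties
  using (≤-refl; ≤-trans; +-mono-≤; m≤m+n; m≤n+m; module ≤-Reasoning)
open import Data.Product.Base using (∃; ∃-syntax; _×_; _,_)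
open import Data.Vec.Base using (_∷_; lookup)
open import Function.Base using (flip; _∘_)
open import Induction.InfiniteDescent using (InfiniteDescendingSequenceFrom)
open import Induction.WellFounded using (Acc; acc)
open import Relation.Binary.PropositionalEquality
  using (_≡_; refl; sym; trans; cong; cong₂; subst; trans-reflʳ)
open import Relation.Nullary.Negation.Core using (¬_)

private variable
  m n o : ℕ
  s t u : Term n

-- Renaming

lift-id : {ρ : Fin n → Fin n} → (∀ i → ρ i ≡ i) → ∀ i → lift 1 ρ i ≡ i
lift-id ρ-id zero    = refl
lift-id ρ-id (suc i) = cong suc (ρ-id i)

rename-id : {ρ : Fin n → Fin n} → (∀ i → ρ i ≡ i) → ∀ t → rename ρ t ≡ t
rename-id ρ-id (var i)   = cong var (ρ-id i)
rename-id ρ-id (t · u)   = cong₂ _·_ (rename-id ρ-id t) (rename-id ρ-id u)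
rename-id ρ-id (ƛ t)     = cong ƛ_ (rename-id (lift-id ρ-id) t)
rename-id ρ-id (t [ u ]) = cong₂ _[_] (rename-id (lift-id ρ-id) t) (rename-id ρ-id u)

lift-∘ : {ρ : Fin n → Fin o} {σ : Fin m → Fin n} {τ : Fin m → Fin o} →
  (∀ i → ρ (σ i) ≡ τ i) → ∀ i → lift 1 ρ (lift 1 σ i) ≡ lift 1 τ i
lift-∘ eq zero    = refl
lift-∘ eq (suc i) = cong suc (eq i)

rename-∘ : {ρ : Fin n → Fin o} {σ : Fin m → Fin n} {τ : Fin m → Fin o} →
  (∀ i → ρ (σ i) ≡ τ i) → ∀ t → rename ρ (rename σ t) ≡ rename τ t
rename-∘ eq (var i)   = cong var (eq i)
rename-∘ eq (t · u)   = cong₂ _·_ (rename-∘ eq t) (rename-∘ eq u)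
rename-∘ eq (ƛ t)     = cong ƛ_ (rename-∘ (lift-∘ eq) t)
rename-∘ eq (t [ u ]) = cong₂ _[_] (rename-∘ (lift-∘ eq) t) (rename-∘ eq u)

rename-weaken : (ρ : Fin m → Fin n) (t : Term m) →
  weaken (rename ρ t) ≡ rename (lift 1 ρ) (weaken t)
rename-weaken ρ t = trans (rename-∘ (λ _ → refl) t) (sym (rename-∘ (λ _ → refl) t))

exchange-lift : (ρ : Fin m → Fin n) → ∀ i →
  lift 1 (lift 1 ρ) (exchange i) ≡ exchange (lift 1 (lift 1 ρ) i)
exchange-lift ρ zero          = refl
exchange-lift ρ (suc zero)    = refl
exchange-lift ρ (suc (suc i)) = refl

rename-exchange : (ρ : Fin m → Fin n) (t : Term (suc (suc m))) →
  rename exchange (rename (lift 1 (lift 1 ρ)) t) ≡ rename (lift 1 (lift 1 ρ)) (rename exchange t)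
rename-exchange ρ t =
  trans (rename-∘ (λ _ → refl) t) (sym (rename-∘ (exchange-lift ρ) t))

-- Which rule applies depends only on the constructors and, for a substituted variable, on whether
-- it is `zero`. Renaming keeps the former and `lift 1 ρ` the latter, so each step can be pulled
-- back.
⟶-rename⁻ : (ρ : Fin m → Fin n) (t : Term m) {s : Term n} →
  rename ρ t ⟶ s → ∃[ t′ ] t ⟶ t′ × rename ρ t′ ≡ s
⟶-rename⁻ ρ ((ƛ t) · u) beta = t [ u ] , beta , refl
⟶-rename⁻ ρ (t · u) (·ˡ r) with _ , r′ , refl ← ⟶-rename⁻ ρ t r = _ , ·ˡ r′ , refl
⟶-rename⁻ ρ (t · u) (·ʳ r) with _ , r′ , refl ← ⟶-rename⁻ ρ u r = _ , ·ʳ r′ , refl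
⟶-rename⁻ ρ (ƛ t) (ƛ-cong r) with _ , r′ , refl ← ⟶-rename⁻ (lift 1 ρ) t r = _ , ƛ-cong r′ , refl
⟶-rename⁻ ρ (var zero [ u ]) []-hit = u , []-hit , refl
⟶-rename⁻ ρ (var (suc i) [ u ]) []-var = var i , []-var , refl
⟶-rename⁻ ρ ((t · u) [ v ]) []-app = _ , []-app , refl
⟶-rename⁻ ρ ((ƛ t) [ u ]) []-lam =
  _ , []-lam , cong ƛ_ (cong₂ _[_] (sym (rename-exchange ρ t)) (sym (rename-weaken ρ u)))
⟶-rename⁻ ρ (t [ u ]) ([]ˡ r) with _ , r′ , refl ← ⟶-rename⁻ (lift 1 ρ) t r = _ , []ˡ r′ , refl
⟶-rename⁻ ρ (t [ u ]) ([]ʳ r) with _ , r′ , refl ← ⟶-rename⁻ ρ u r = _ , []ʳ r′ , refl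

-- Strong normalization

-- The renaming in `body` is there for the rule []-lam, whose contractum
-- substitutes into a renamed body.  The subterms of t [ u ] are not included:
-- no rule moves a substitution through another one.
data _≺_ : ∃ Term → ∃ Term → Set where
  red  : t ⟶ s → (n , s) ≺ (n , t)
  fun  : (n , t) ≺ (n , t · u)
  arg  : (n , u) ≺ (n , t · u)
  body : (ρ : Fin (suc m) → Fin n) → (n , rename ρ t) ≺ (m , ƛ t)

-- Accessibility for `_≺_`, rather than for reduction alone, lets a single induction descend to
-- reducts and to subterms.
SN : Term n → Set
SN {n} t = Acc _≺_ (n , t)

SN⇒no-descent : SN t → ∀ f → ¬ InfiniteDescendingSequenceFrom (flip _⟶_) f t
SN⇒no-descent (acc h) f (refl , f⟶) =
  SN⇒no-descent (h (red (f⟶ 0))) (f ∘ suc) (refl , f⟶ ∘ suc)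

SN-var : (i : Fin n) → SN (var i)
SN-var i = acc λ { (red ()) }

SN-body : SN (ƛ t) → SN t
SN-body {t = t} (acc h) = subst SN (rename-id (λ _ → refl) t) (h (body (λ i → i)))

mutual
  SN-rename : (ρ : Fin m → Fin n) → SN t → SN (rename ρ t)
  SN-rename {t = t} ρ h = acc (SN-rename-≺ ρ t h)

  SN-rename-≺ : (ρ : Fin m → Fin n) (t : Term m) → SN t →
    ∀ {x} → x ≺ (n , rename ρ t) → Acc _≺_ x
  SN-rename-≺ ρ (t · u) (acc h) fun = SN-rename ρ (h fun)
  SN-rename-≺ ρ (t · u) (acc h) arg = SN-rename ρ (h arg)
  SN-rename-≺ ρ (ƛ t)   (acc h) (body σ) =
    -- Renamings compose, so a renamed body of `rename ρ (ƛ t)` is already a renamed body of `ƛ t`.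
    subst SN (sym (rename-∘ (λ _ → refl) t)) (h (body (σ ∘ lift 1 ρ)))
  SN-rename-≺ ρ t (acc h) (red r) with _ , r′ , refl ← ⟶-rename⁻ ρ t r =
    SN-rename ρ (h (red r′))

SN-ƛ : SN t → SN (ƛ t)
SN-ƛ h@(acc h′) = acc λ
  { (red (ƛ-cong r)) → SN-ƛ (h′ (red r))
  ; (body ρ)         → SN-rename ρ h
  }

-- Functionals

module _ {Atom : Set} where

  private variable
    A B : Type Atom
    Γ Δ : Ctx Atom n

  ⟦_⟧ : Type Atom → Set
  ⟦ atom _ ⟧ = ℕ
  ⟦ A ⇒ B ⟧  = ⟦ A ⟧ → ⟦ B ⟧

  -- Reflexive only at the hereditarily monotone functionals.
  Below : ∀ A → ⟦ A ⟧ → ⟦ A ⟧ → Set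
  Below (atom _) a b = a ≤ b
  Below (A ⇒ B)  f g = ∀ {a b} → Below A a b → Below B (f a) (g b)

  𝟎 : ∀ A → ⟦ A ⟧
  𝟎 (atom _) = 0
  𝟎 (A ⇒ B)  = λ _ → 𝟎 B

  size : ∀ A → ⟦ A ⟧ → ℕ
  size (atom _) a = a
  size (A ⇒ B)  f = size B (f (𝟎 A))

  raise : ∀ A → ℕ → ⟦ A ⟧ → ⟦ A ⟧
  raise (atom _) k a = k + a
  raise (A ⇒ B)  k f = λ a → raise B k (f a)

  𝟎-mono : ∀ A → Below A (𝟎 A) (𝟎 A)
  𝟎-mono (atom _) = z≤n
  𝟎-mono (A ⇒ B)  = λ _ → 𝟎-mono B

  size-mono : ∀ A {a b} → Below A a b → size A a ≤ size A b
  size-mono (atom _) a≤b = a≤b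
  size-mono (A ⇒ B)  f≤g = size-mono B (f≤g (𝟎-mono A))

  raise-mono : ∀ A {k l a b} → k ≤ l → Below A a b → Below A (raise A k a) (raise A l b)
  raise-mono (atom _) k≤l a≤b = +-mono-≤ k≤l a≤b
  raise-mono (A ⇒ B)  k≤l f≤g = λ a≤b → raise-mono B k≤l (f≤g a≤b)

  below-raise : ∀ A {k a b} → Below A a b → Below A a (raise A k b)
  below-raise (atom _) {k} {b = b} a≤b = ≤-trans a≤b (m≤n+m b k)
  below-raise (A ⇒ B)              f≤g = λ a≤b → below-raise B (f≤g a≤b)

  size-raise : ∀ A k a → size A (raise A k a) ≡ k + size A a
  size-raise (atom _) k a = refl
  size-raise (A ⇒ B)  k f = size-raise B k (f (𝟎 A))

  -- Interpretation of typing derivations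

  Env : Ctx Atom n → Set
  Env Γ = ∀ i → ⟦ lookup Γ i ⟧

  infixr 5 _◂_
  _◂_ : ⟦ A ⟧ → Env Γ → Env (A ∷ Γ)
  (a ◂ γ) zero    = a
  (a ◂ γ) (suc i) = γ i

  BelowEnv : (Γ : Ctx Atom n) → Env Γ → Env Γ → Set
  BelowEnv Γ γ δ = ∀ i → Below (lookup Γ i) (γ i) (δ i)

  ◂-mono : ∀ {a b γ δ} → Below A a b → BelowEnv Γ γ δ → BelowEnv (A ∷ Γ) (a ◂ γ) (b ◂ δ)
  ◂-mono a≤b γ≤δ zero    = a≤b
  ◂-mono a≤b γ≤δ (suc i) = γ≤δ i

  -- The two sizes serve `label-fun` and `label-arg`; the `suc` makes `label-beta` strict.
  apply : ∀ A B → ⟦ A ⇒ B ⟧ → ⟦ A ⟧ → ⟦ B ⟧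
  apply A B f a = raise B (suc (size (A ⇒ B) f + size A a)) (f a)

  apply-mono : ∀ A B {f g a b} → Below (A ⇒ B) f g → Below A a b →
    Below B (apply A B f a) (apply A B g b)
  apply-mono A B {f} {g} f≤g a≤b =
    raise-mono B (s≤s (+-mono-≤ (size-mono (A ⇒ B) {f} {g} f≤g) (size-mono A a≤b))) (f≤g a≤b)

  eval : Γ ⊢ t ∶ A → Env Γ → ⟦ A ⟧
  eval (⊢var {i = i} eq) γ = subst ⟦_⟧ eq (γ i)
  eval (⊢sub e d) γ = eval d (eval e γ ◂ γ)
  eval (⊢app {A = A} {B} d e) γ = apply B A (eval d γ) (eval e γ)
  eval (⊢lam d) γ = λ a → eval d (a ◂ γ)

  infix 4 _⊑_
  -- The environments are related, not equal: `Below` at an arrow type compares functions on related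
  -- arguments, which enter the environments under a binder.
  _⊑_ : Γ ⊢ t ∶ A → Γ ⊢ u ∶ A → Set
  _⊑_ {Γ = Γ} {A = A} d e = ∀ {γ δ} → BelowEnv Γ γ δ → Below A (eval d γ) (eval e δ)

  eval-mono : (d : Γ ⊢ t ∶ A) → d ⊑ d
  eval-mono (⊢var {i = i} refl) γ≤δ = γ≤δ i
  eval-mono (⊢sub e d) γ≤δ = eval-mono d (◂-mono (eval-mono e γ≤δ) γ≤δ)
  eval-mono (⊢app {A = A} {B} d e) γ≤δ = apply-mono B A (eval-mono d γ≤δ) (eval-mono e γ≤δ)
  eval-mono (⊢lam d) γ≤δ = λ a≤b → eval-mono d (◂-mono a≤b γ≤δ)

  -- Renaming and reduction of typing derivations

  record Renaming (Γ : Ctx Atom m) (Δ : Ctx Atom n) (ρ : Fin m → Fin n) : Set where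
    field lookup-renamed : ∀ i → lookup Δ (ρ i) ≡ lookup Γ i
  open Renaming

  lift-renaming : {ρ : Fin m → Fin n} → Renaming Γ Δ ρ → Renaming (A ∷ Γ) (A ∷ Δ) (lift 1 ρ)
  lift-renaming r .lookup-renamed zero    = refl
  lift-renaming r .lookup-renamed (suc i) = r .lookup-renamed i

  suc-renaming : Renaming Γ (A ∷ Γ) suc
  suc-renaming .lookup-renamed i = refl

  exchange-renaming : Renaming (A ∷ B ∷ Γ) (B ∷ A ∷ Γ) exchange
  exchange-renaming .lookup-renamed zero          = refl
  exchange-renaming .lookup-renamed (suc zero)    = refl
  exchange-renaming .lookup-renamed (suc (suc i)) = refl

  ⊢rename : {ρ : Fin m → Fin n} → Renaming Γ Δ ρ → Γ ⊢ t ∶ A → Δ ⊢ rename ρ t ∶ A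
  ⊢rename r (⊢var {i = i} eq) = ⊢var (trans (r .lookup-renamed i) eq)
  ⊢rename r (⊢sub e d) = ⊢sub (⊢rename r e) (⊢rename (lift-renaming r) d)
  ⊢rename r (⊢app d e) = ⊢app (⊢rename r d) (⊢rename r e)
  ⊢rename r (⊢lam d)   = ⊢lam (⊢rename (lift-renaming r) d)

  record BelowAlong {ρ : Fin m → Fin n} (r : Renaming Γ Δ ρ) (δ : Env Δ) (γ : Env Γ) : Set where
    field below : ∀ i → Below (lookup Γ i) (subst ⟦_⟧ (r .lookup-renamed i) (δ (ρ i))) (γ i)
  open BelowAlong

  ◂-along : {ρ : Fin m → Fin n} {r : Renaming Γ Δ ρ} → ∀ {a b δ γ} → Below A a b →
    BelowAlong r δ γ → BelowAlong (lift-renaming r) (a ◂ δ) (b ◂ γ)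
  ◂-along a≤b δ≤γ .below zero    = a≤b
  ◂-along a≤b δ≤γ .below (suc i) = δ≤γ .below i

  suc-along : ∀ {a : ⟦ A ⟧} {δ γ : Env Γ} → BelowEnv Γ δ γ → BelowAlong (suc-renaming {Γ = Γ} {A = A}) (a ◂ δ) γ
  suc-along δ≤γ .below = δ≤γ

  exchange-along : ∀ {a a′ : ⟦ A ⟧} {b b′ : ⟦ B ⟧} {δ γ : Env Γ} →
    Below A a a′ → Below B b b′ → BelowEnv Γ δ γ →
    BelowAlong (exchange-renaming {Γ = Γ}) (b ◂ a ◂ δ) (a′ ◂ b′ ◂ γ)
  exchange-along a≤a′ b≤b′ δ≤γ .below zero          = a≤a′
  exchange-along a≤a′ b≤b′ δ≤γ .below (suc zero)    = b≤b′
  exchange-along a≤a′ b≤b′ δ≤γ .below (suc (suc i)) = δ≤γ i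

  -- Equality of values at arrow types would call for function extensionality; `Below` avoids it and
  -- suffices for the rule `[]-lam`.
  eval-⊢rename : {ρ : Fin m → Fin n} {r : Renaming Γ Δ ρ} (d : Γ ⊢ t ∶ A) →
    ∀ {δ γ} → BelowAlong r δ γ → Below A (eval (⊢rename r d) δ) (eval d γ)
  eval-⊢rename {r = r} (⊢var {i = i} refl) δ≤γ
    rewrite trans-reflʳ (r .lookup-renamed i) = δ≤γ .below i
  eval-⊢rename (⊢sub e d) δ≤γ = eval-⊢rename d (◂-along (eval-⊢rename e δ≤γ) δ≤γ)
  eval-⊢rename (⊢app {A = A} {B} d e) δ≤γ =
    apply-mono B A (eval-⊢rename d δ≤γ) (eval-⊢rename e δ≤γ)
  eval-⊢rename (⊢lam d) δ≤γ = λ a≤b → eval-⊢rename d (◂-along a≤b δ≤γ)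

  subject-reduction : (d : Γ ⊢ t ∶ A) → t ⟶ s → ∃[ d′ ] _⊑_ {Γ = Γ} {t = s} {A} d′ d
  subject-reduction {A = A} (⊢app (⊢lam d) e) beta =
    -- The contractum evaluates to the application without its raise.
    ⊢sub e d , λ γ≤δ → below-raise A (eval-mono d (◂-mono (eval-mono e γ≤δ) γ≤δ))
  subject-reduction (⊢sub e (⊢app d₁ d₂)) []-app =
    -- Both sides compute to the same value, so monotonicity is enough.
    ⊢app (⊢sub e d₁) (⊢sub e d₂) , eval-mono (⊢sub e (⊢app d₁ d₂))
  subject-reduction {Γ = Γ} (⊢sub e (⊢lam d)) []-lam =
    ⊢lam (⊢sub (⊢rename suc-renaming e) (⊢rename exchange-renaming d)) ,
    -- The reduct binds the abstraction's argument and the value of `e` in the opposite order, with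
    -- `e` evaluated in an environment extended by that argument.
    λ γ≤δ a≤b → eval-⊢rename d (exchange-along {Γ = Γ} a≤b (eval-⊢rename e (suc-along γ≤δ)) γ≤δ)
  subject-reduction (⊢sub e (⊢var refl)) []-hit = e , eval-mono e
  subject-reduction (⊢sub e (⊢var refl)) ([]-var {i}) = ⊢var refl , λ γ≤δ → γ≤δ i
  subject-reduction (⊢app {A = A} {B} d e) (·ˡ r) with d′ , d′⊑d ← subject-reduction d r =
    ⊢app d′ e , λ γ≤δ → apply-mono B A (d′⊑d γ≤δ) (eval-mono e γ≤δ)
  subject-reduction (⊢app {A = A} {B} d e) (·ʳ r) with e′ , e′⊑e ← subject-reduction e r =
    ⊢app d e′ , λ γ≤δ → apply-mono B A (eval-mono d γ≤δ) (e′⊑e γ≤δ)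
  subject-reduction (⊢lam d) (ƛ-cong r) with d′ , d′⊑d ← subject-reduction d r =
    ⊢lam d′ , λ γ≤δ a≤b → d′⊑d (◂-mono a≤b γ≤δ)
  subject-reduction (⊢sub e d) ([]ˡ r) with d′ , d′⊑d ← subject-reduction d r =
    ⊢sub e d′ , λ γ≤δ → d′⊑d (◂-mono (eval-mono e γ≤δ) γ≤δ)
  subject-reduction (⊢sub e d) ([]ʳ r) with e′ , e′⊑e ← subject-reduction e r =
    ⊢sub e′ d , λ γ≤δ → eval-mono d (◂-mono (e′⊑e γ≤δ) γ≤δ)

  -- Labels

  zeroEnv : (Γ : Ctx Atom n) → Env Γ
  zeroEnv Γ i = 𝟎 (lookup Γ i)

  label : Γ ⊢ t ∶ A → ℕ
  label {Γ = Γ} {A = A} d = size A (eval d (zeroEnv Γ))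

  label-mono : (d : Γ ⊢ t ∶ A) (e : Γ ⊢ u ∶ A) → d ⊑ e → label d ≤ label e
  label-mono {Γ = Γ} {A = A} d e d⊑e = size-mono A (d⊑e λ i → 𝟎-mono (lookup Γ i))

  label-app : (d : Γ ⊢ t ∶ A ⇒ B) (e : Γ ⊢ u ∶ A) →
    label (⊢app d e) ≡ suc (label d + label e + size B (eval d (zeroEnv Γ) (eval e (zeroEnv Γ))))
  label-app {B = B} d e = size-raise B _ _

  label-fun : (d : Γ ⊢ t ∶ A ⇒ B) (e : Γ ⊢ u ∶ A) → label d ≤ label (⊢app d e)
  label-fun d e = begin
    label d                     ≤⟨ m≤m+n _ _ ⟩
    label d + label e           ≤⟨ m≤m+n _ _ ⟩
    label d + label e + _       ≤⟨ m≤n+m _ 1 ⟩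
    suc (label d + label e + _) ≡⟨ label-app d e ⟨
    label (⊢app d e)            ∎
    where open ≤-Reasoning

  label-arg : (d : Γ ⊢ t ∶ A ⇒ B) (e : Γ ⊢ u ∶ A) → label e ≤ label (⊢app d e)
  label-arg d e = begin
    label e                     ≤⟨ m≤n+m _ (label d) ⟩
    label d + label e           ≤⟨ m≤m+n _ _ ⟩
    label d + label e + _       ≤⟨ m≤n+m _ 1 ⟩
    suc (label d + label e + _) ≡⟨ label-app d e ⟨
    label (⊢app d e)            ∎
    where open ≤-Reasoning

  label-beta : (d : (A ∷ Γ) ⊢ t ∶ B) (e : Γ ⊢ u ∶ A) →
    label (⊢sub e d) < label (⊢app (⊢lam d) e)
  label-beta d e = begin-strict
    -- By computation, this label is the last summand in `label-app`.
    label (⊢sub e d)                                  ≤⟨ m≤n+m _ _ ⟩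
    label (⊢lam d) + label e + label (⊢sub e d)       <⟨ ≤-refl ⟩
    suc (label (⊢lam d) + label e + label (⊢sub e d)) ≡⟨ label-app (⊢lam d) e ⟨
    label (⊢app (⊢lam d) e)                           ∎
    where open ≤-Reasoning

  label-body : (d : (A ∷ Γ) ⊢ t ∶ B) → label d ≤ label (⊢lam d)
  -- `𝟎 A ◂ zeroEnv Γ` and `zeroEnv (A ∷ Γ)` agree only pointwise, hence the passage through
  -- monotonicity.
  label-body {A = A} {Γ = Γ} {B = B} d = size-mono B (eval-mono d λ
    { zero    → 𝟎-mono A
    ; (suc i) → 𝟎-mono (lookup Γ i)
    })

  subject-reduction-≤ : ∀ {k} (d : Γ ⊢ t ∶ A) → label d ≤ k → t ⟶ s →
    ∃[ d′ ] label {Γ = Γ} {t = s} {A} d′ ≤ k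
  subject-reduction-≤ d d≤k r with d′ , d′⊑d ← subject-reduction d r =
    d′ , ≤-trans (label-mono d′ d d′⊑d) d≤k

  -- Strong normalization of typed applications and substitutions

  mutual
    -- The recursion is lexicographic in `k`, `SN t` and `SN u`. As a mere bound, `k` stays fixed
    -- when a step changes the label.
    SN-· : ∀ k (d : Γ ⊢ t · u ∶ A) → label d ≤ k → SN t → SN u → SN (t · u)
    SN-· k d d≤k ht hu = acc λ
      { (red r) → SN-·-⟶ k d d≤k ht hu r
      ; fun     → ht
      ; arg     → hu
      }

    SN-·-⟶ : ∀ k (d : Γ ⊢ t · u ∶ A) → label d ≤ k → SN t → SN u → t · u ⟶ s → SN s
    SN-·-⟶ k (⊢app (⊢lam d) e) d≤k ht hu beta
      -- Strictness forces `k` to be a successor; the recursive call uses its predecessor.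
      with s≤s d′≤k ← ≤-trans (label-beta d e) d≤k =
      SN-[] _ (⊢sub e d) d′≤k (SN-body ht) hu
    SN-·-⟶ k d d≤k (acc ht) hu r@(·ˡ r′)
      with d′ , d′≤k ← subject-reduction-≤ d d≤k r =
      SN-· k d′ d′≤k (ht (red r′)) hu
    SN-·-⟶ k d d≤k ht (acc hu) r@(·ʳ r′)
      with d′ , d′≤k ← subject-reduction-≤ d d≤k r =
      SN-· k d′ d′≤k ht (hu (red r′))

    SN-[] : ∀ k (d : Γ ⊢ t [ u ] ∶ A) → label d ≤ k → SN t → SN u → SN (t [ u ])
    SN-[] k d d≤k ht hu = acc λ { (red r) → SN-[]-⟶ k d d≤k ht hu r }

    SN-[]-⟶ : ∀ k (d : Γ ⊢ t [ u ] ∶ A) → label d ≤ k → SN t → SN u → t [ u ] ⟶ s → SN s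
    SN-[]-⟶ k d d≤k (acc ht) hu []-app
      with ⊢app d₁ d₂ , d′≤k ← subject-reduction-≤ d d≤k []-app =
      -- The arguments of this call are not smaller, but `SN-·` returns to `SN-[]` only through
      -- `beta`, where `k` drops.
      SN-· k (⊢app d₁ d₂) d′≤k
        (SN-[] k d₁ (≤-trans (label-fun d₁ d₂) d′≤k) (ht fun) hu)
        (SN-[] k d₂ (≤-trans (label-arg d₁ d₂) d′≤k) (ht arg) hu)
    SN-[]-⟶ k d d≤k (acc ht) hu []-lam
      with ⊢lam d′ , d′≤k ← subject-reduction-≤ d d≤k []-lam =
      -- `SN-rename suc hu` is not smaller than `hu`; the descent is in the accessibility of the
      -- body.
      SN-ƛ (SN-[] k d′ (≤-trans (label-body d′) d′≤k) (ht (body exchange)) (SN-rename suc hu))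
    SN-[]-⟶ k d d≤k ht hu []-hit = hu
    SN-[]-⟶ k d d≤k ht hu ([]-var {i}) = SN-var i
    SN-[]-⟶ k d d≤k (acc ht) hu r@([]ˡ r′)
      with d′ , d′≤k ← subject-reduction-≤ d d≤k r =
      SN-[] k d′ d′≤k (ht (red r′)) hu
    SN-[]-⟶ k d d≤k ht (acc hu) r@([]ʳ r′)
      with d′ , d′≤k ← subject-reduction-≤ d d≤k r =
      SN-[] k d′ d′≤k ht (hu (red r′))

  SN-typed : Γ ⊢ t ∶ A → SN t
  SN-typed (⊢var {i = i} _) = SN-var i
  SN-typed d@(⊢sub e d′)    = SN-[] _ d ≤-refl (SN-typed d′) (SN-typed e)
  SN-typed d@(⊢app d₁ d₂)   = SN-· _ d ≤-refl (SN-typed d₁) (SN-typed d₂)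
  SN-typed (⊢lam d)         = SN-ƛ (SN-typed d)

corollary3p2 : {Atom : Set} {n : ℕ} {Γ : Ctx Atom n} {t : Term n} {A : Type Atom} →
    Γ ⊢ t ∶ A → ¬ (∃[ f ] InfiniteDescendingSequenceFrom (flip _⟶_) f t)
corollary3p2 d (f , f-desc) = SN⇒no-descent (SN-typed d) f f-desc
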